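{- Let $M$ be a matroid. If $M$ has two distinct bases that are disjoint, or its dual $M^\star$ has two distinct bases that are disjoint, then $M$ has the Borsuk property.
   Context: All matroids are finite. For a matroid $M$, $\mathcal{B}(M)$ denotes its set of bases, and the distance between two bases $B,B'$ is $|B\triangle B'|$ (symmetric difference); $\operatorname{diam}$ denotes the diameter with respect to this distance. The Borsuk number $f(M)$ is the minimum number of parts in a partition of $\mathcal{B}(M)$ in which every part has diameter strictly smaller than $\operatorname{diam}(\mathcal{B}(M))$; if $M$ has exactly one basis, $f(M):=+\infty$. If $M$ has $n$ elements and $c$ connected components, $M$ has the Borsuk property if $f(M)\le n-c+1$. -}

module Defs where

open import Level using (0ℓ)
open import Data.Nat using (ℕ; suc; _+_; _∸_; _≤_; _<_; s≤s⁻¹)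
open import Data.Nat.Properties using (≤-refl; <-≤-trans)
open import Data.Fin using (Fin; zero; suc)
import Data.Empty
import Data.Fin.Properties as Fin
open import Data.Fin.Subset
open import Data.Fin.Subset.Properties
open import Data.Vec using ([]; _∷_; here; there)
open import Data.List using (List; []; map; _++_; filter; length; deduplicate; allFin; cartesianProductWith)
open import Data.List.Extrema.Nat using (max)
open import Data.Product using (∃; ∃₂; ∃!; _×_; _,_; proj₁; proj₂)
open import Data.Sum using (_⊎_; inj₁; inj₂)
open import Function using (_∘_)
open import Relation.Nullary using (¬_; Dec; yes; no; contradiction)
open import Relation.Nullary.Decidable using (¬?; _×-dec_; _⊎-dec_; map′; decidable-stable)
open import Relation.Nullary.Construct.Add.Supremum using (_⁺; [_]; ⊤⁺)
open import Relation.Unary using (Pred; Decidable)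
import Relation.Binary.Definitions as B
open import Relation.Binary.Construct.Add.Supremum.NonStrict _≤_ using (_≤⁺_)
open import Relation.Binary.PropositionalEquality using (_≡_; _≢_; refl; sym; subst)

private variable
  n : ℕ

-- Matroids on the ground set Fin n, given by their bases.  Decidability of
-- the family of bases makes it a finite set of subsets.
record Matroid (n : ℕ) : Set₁ where
  field
    Basis    : Pred (Subset n) 0ℓ
    basis?   : Decidable Basis
    nonempty : ∃ Basis
    exchange : ∀ {A B x} → Basis A → Basis B → x ∈ A → x ∉ B →
               ∃ λ y → y ∈ B × y ∉ A × Basis ((A - x) ∪ ⁅ y ⁆)

open Matroid public using (Basis)

private
  ∈-minus⇒≢ : ∀ {p : Subset n} {x y} → x ∈ p - y → x ≢ y
  ∈-minus⇒≢ {p = _ ∷ _} {zero}  ()        refl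
  ∈-minus⇒≢ {p = _ ∷ _} {suc _} (there i) refl = ∈-minus⇒≢ i refl

  swap⁻ : ∀ (p : Subset n) x y {w} → w ∈ (p - x) ∪ ⁅ y ⁆ → (w ∈ p × w ≢ x) ⊎ w ≡ y
  swap⁻ p x y i with x∈p∪q⁻ (p - x) ⁅ y ⁆ i
  ... | inj₁ j = inj₁ (p─q⊆p p ⁅ x ⁆ j , ∈-minus⇒≢ j)
  ... | inj₂ j = inj₂ (x∈⁅y⁆⇒x≡y y j)

  swap-old : ∀ {p : Subset n} {x y w} → w ∈ p → w ≢ x → w ∈ (p - x) ∪ ⁅ y ⁆
  swap-old i ≢x = x∈p∪q⁺ (inj₁ (x∈p∧x≢y⇒x∈p-y i ≢x))

  swap-new : ∀ {p : Subset n} {x y} → y ∈ (p - x) ∪ ⁅ y ⁆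
  swap-new {y = y} = x∈p∪q⁺ (inj₂ (x∈⁅x⁆ y))

  module _ (M : Matroid n) where
    open Matroid M using (basis?; exchange)

    antichain : ∀ {A B} → Basis M A → Basis M B → A ⊆ B → A ≡ B
    antichain {A} {B} bA bB A⊆B = ⊆-antisym A⊆B λ {x} x∈B →
      decidable-stable (x ∈? A) λ x∉A →
        let (y , y∈A , y∉B , _) = exchange bB bA x∈B x∉A in y∉B (A⊆B y∈A)

    coexchange : ∀ m {A B x} → ∣ B ─ A ∣ ≤ m → Basis M A → Basis M B → x ∈ B → x ∉ A →
                 ∃ λ y → y ∈ A × y ∉ B × Basis M ((A - y) ∪ ⁅ x ⁆)
    coexchange m {A} {B} {x} le bA bB x∈B x∉A
      with Fin.any? (λ z → (z ∈? B) ×-dec ¬? (z ∈? A) ×-dec ¬? (z Fin.≟ x))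
    ... | no none = y , y∈A , y∉B , subst (Basis M) (⊆-antisym to from) bB
      where
      ex  = exchange bB bA x∈B x∉A
      y   = proj₁ ex
      y∈A = proj₁ (proj₂ ex)
      y∉B = proj₁ (proj₂ (proj₂ ex))
      bB′ = proj₂ (proj₂ (proj₂ ex))

      B′⊆A : (B - x) ∪ ⁅ y ⁆ ⊆ A
      B′⊆A {w} i with swap⁻ B x y i
      ... | inj₂ refl = y∈A
      ... | inj₁ (w∈B , w≢x) = decidable-stable (w ∈? A) λ w∉A → none (w , w∈B , w∉A , w≢x)

      B′≡A = antichain bB′ bA B′⊆A

      to : B ⊆ (A - y) ∪ ⁅ x ⁆
      to {w} w∈B with w Fin.≟ x
      ... | yes refl = swap-new {p = A} {x = y}
      ... | no w≢x = swap-old (B′⊆A (swap-old w∈B w≢x)) λ { refl → y∉B w∈B }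

      from : (A - y) ∪ ⁅ x ⁆ ⊆ B
      from {w} i with swap⁻ A y x i
      ... | inj₂ refl = x∈B
      ... | inj₁ (w∈A , w≢y) with swap⁻ B x y (subst (w ∈_) (sym B′≡A) w∈A)
      ...   | inj₁ (w∈B , _) = w∈B
      ...   | inj₂ w≡y = contradiction w≡y w≢y
    ... | yes (z , z∈B , z∉A , z≢x) = step m le
      where
      ex  = exchange bB bA z∈B z∉A
      y   = proj₁ ex
      y∈A = proj₁ (proj₂ ex)
      B′  = (B - z) ∪ ⁅ y ⁆
      bB′ = proj₂ (proj₂ (proj₂ ex))

      z∈B─A : z ∈ B ─ A
      z∈B─A = x∈p∧x∉q⇒x∈p─q z∈B z∉A

      ∈─⇒∉ : ∀ {k} {p q : Subset k} {w} → w ∈ p ─ q → w ∉ q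
      ∈─⇒∉ {p = _ ∷ _} {q = _ ∷ _} {zero}  ()        here
      ∈─⇒∉ {p = _ ∷ _} {q = _ ∷ _} {suc _} (there i) (there j) = ∈─⇒∉ i j

      shrink : B′ ─ A ⊂ B ─ A
      shrink = sub , z , z∈B─A , z∉
        where
        sub : B′ ─ A ⊆ B ─ A
        sub {w} i with swap⁻ B z y (p─q⊆p B′ A i)
        ... | inj₁ (w∈B , _) = x∈p∧x∉q⇒x∈p─q w∈B (∈─⇒∉ i)
        ... | inj₂ refl = contradiction y∈A (∈─⇒∉ i)
        z∉ : z ∉ B′ ─ A
        z∉ i with swap⁻ B z y (p─q⊆p B′ A i)
        ... | inj₁ (_ , z≢z) = z≢z refl
        ... | inj₂ z≡y = z∉A (subst (_∈ A) (sym z≡y) y∈A)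

      step : ∀ k → ∣ B ─ A ∣ ≤ k → ∃ λ y → y ∈ A × y ∉ B × Basis M ((A - y) ∪ ⁅ x ⁆)
      step 0       l = contradiction (<-≤-trans (p⊂q⇒∣p∣<∣q∣ shrink) l) λ ()
      step (suc k) l =
        let (u , u∈A , u∉B′ , b) = coexchange k (s≤s⁻¹ (<-≤-trans (p⊂q⇒∣p∣<∣q∣ shrink) l))
                                     bA bB′ (swap-old x∈B (z≢x ∘ sym)) x∉A
        in u , u∈A , (λ u∈B → u∉B′ (swap-old u∈B λ u≡z → z∉A (subst (_∈ A) u≡z u∈A))) , b

infix 10 _⋆
_⋆ : Matroid n → Matroid n
_⋆ {n} M = record
  { Basis    = λ A → Basis M (∁ A)
  ; basis?   = λ A → basis? (∁ A)
  ; nonempty = let (B , bB) = nonempty in ∁ B , subst (Basis M) (sym (∁-involutive B)) bB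
  ; exchange = dual-exchange
  }
  where
  open Matroid M using (basis?; nonempty)

  ∁-involutive : ∀ (p : Subset n) → ∁ (∁ p) ≡ p
  ∁-involutive p = ⊆-antisym (x∉∁p⇒x∈p ∘ x∈∁p⇒x∉p) (x∉p⇒x∈∁p ∘ x∈p⇒x∉∁p)

  dual-exchange : ∀ {A B x} → Basis M (∁ A) → Basis M (∁ B) → x ∈ A → x ∉ B →
                  ∃ λ y → y ∈ B × y ∉ A × Basis M (∁ ((A - x) ∪ ⁅ y ⁆))
  dual-exchange {A} {B} {x} bA bB x∈A x∉B
    with coexchange M ∣ ∁ B ─ ∁ A ∣ ≤-refl bA bB (x∉p⇒x∈∁p x∉B) (x∈p⇒x∉∁p x∈A)
  ... | y , y∈∁A , y∉∁B , b =
    y , x∉∁p⇒x∈p y∉∁B , x∈∁p⇒x∉p y∈∁A , subst (Basis M) (⊆-antisym to from) b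
    where
    to : (∁ A - y) ∪ ⁅ x ⁆ ⊆ ∁ ((A - x) ∪ ⁅ y ⁆)
    to {w} i = x∉p⇒x∈∁p λ j → clash (swap⁻ (∁ A) y x i) (swap⁻ A x y j)
      where
      clash : (w ∈ ∁ A × w ≢ y) ⊎ w ≡ x → (w ∈ A × w ≢ x) ⊎ w ≡ y → Data.Empty.⊥
      clash (inj₁ (w∈∁A , _)) (inj₁ (w∈A , _)) = x∈∁p⇒x∉p w∈∁A w∈A
      clash (inj₁ (_ , w≢y))  (inj₂ w≡y)       = w≢y w≡y
      clash (inj₂ w≡x)        (inj₁ (_ , w≢x)) = w≢x w≡x
      clash (inj₂ refl)       (inj₂ refl)      = x∈∁p⇒x∉p y∈∁A x∈A

    from : ∁ ((A - x) ∪ ⁅ y ⁆) ⊆ (∁ A - y) ∪ ⁅ x ⁆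
    from {w} i with w Fin.≟ x
    ... | yes refl = swap-new {p = ∁ A} {x = y}
    ... | no w≢x = swap-old
      (x∉p⇒x∈∁p λ w∈A → x∈∁p⇒x∉p i (swap-old w∈A w≢x))
      (λ { refl → x∈∁p⇒x∉p i (swap-new {p = A} {x = x}) })

HasDisjointBases : Matroid n → Set
HasDisjointBases M = ∃₂ λ A B → Basis M A × Basis M B × A ≢ B × Empty (A ∩ B)

module _ (M : Matroid n) where
  open Matroid M using (basis?)

  Independent : Pred (Subset n) 0ℓ
  Independent A = ∃ λ B → Basis M B × A ⊆ B

  independent? : Decidable Independent
  independent? A = anySubset? λ B → basis? B ×-dec (A ⊆? B)

  Circuit : Pred (Subset n) 0ℓ
  Circuit C = ¬ Independent C × (∀ A → A ⊂ C → Independent A)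

  circuit? : Decidable Circuit
  circuit? C = ¬? (independent? C) ×-dec
    map′ (λ none A A⊂C → decidable-stable (independent? A) λ dep → none (A , A⊂C , dep))
         (λ { all (A , A⊂C , dep) → dep (all A A⊂C) })
         (¬? (anySubset? λ A → (A ⊂? C) ×-dec ¬? (independent? A)))

  Connected : Fin n → Fin n → Set
  Connected x y = x ≡ y ⊎ ∃ λ C → Circuit C × x ∈ C × y ∈ C

  connected? : B.Decidable Connected
  connected? x y = (x Fin.≟ y) ⊎-dec
    anySubset? λ C → circuit? C ×-dec (x ∈? C) ×-dec (y ∈? C)

  -- Connected is an equivalence relation whose classes are the connected
  -- components; deduplicate keeps exactly one element of each class.
  #components : ℕ
  #components = length (deduplicate connected? (allFin n))

dist : Subset n → Subset n → ℕ
dist A B = ∣ (A ─ B) ∪ (B ─ A) ∣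

diam : List (Subset n) → ℕ
diam 𝓐 = max 0 (cartesianProductWith dist 𝓐 𝓐)

subsets : ∀ n → List (Subset n)
subsets 0       = Data.List.[ [] ]
subsets (suc n) = map (outside ∷_) (subsets n) ++ map (inside ∷_) (subsets n)

bases : Matroid n → List (Subset n)
bases {n} M = filter (Matroid.basis? M) (subsets n)

-- A partition of the set of bases into k nonempty parts of smaller diameter;
-- the values of colour on subsets that are not bases are irrelevant.
record BorsukPartition (M : Matroid n) (k : ℕ) : Set where
  field
    colour : Subset n → Fin k

  part : Fin k → List (Subset n)
  part i = filter (λ B → colour B Fin.≟ i) (bases M)

  field
    part-nonempty : ∀ i → part i ≢ []
    part-diam     : ∀ i → diam (part i) < diam (bases M)

HasUniqueBasis : Matroid n → Set
HasUniqueBasis M = ∃! _≡_ (Basis M)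

-- IsBorsukNumber M v: the Borsuk number f(M) equals v, where ⊤⁺ is +∞.
IsBorsukNumber : Matroid n → ℕ ⁺ → Set
IsBorsukNumber M ⊤⁺    = HasUniqueBasis M
IsBorsukNumber M [ k ] = ¬ HasUniqueBasis M × BorsukPartition M k ×
                         (∀ j → BorsukPartition M j → k ≤ j)

-- f(M) ≤ n − c + 1; the truncated subtraction is exact because c ≤ n.
BorsukProperty : Matroid n → Set
BorsukProperty {n} M =
  ∃ λ v → IsBorsukNumber M v × v ≤⁺ [ n ∸ #components M + 1 ]

{-# OPTIONS --safe #-}

-- Fix a basis A and e ∈ A, and let S be the set of x ∉ A that can be exchanged
-- for some a ∈ A.  If M has disjoint bases, all bases having the same size, two
-- bases that share an element are at distance less than the diameter.  Every
-- basis meets T = S ∪ {e}, since a basis avoiding S lies inside A, so colouring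
-- a basis by an element of T that it contains uses at most |S| + 1 colours.
-- Sending each x ∈ S to an a it can be exchanged for, and fixing all other
-- elements, identifies only connected elements (through fundamental circuits),
-- so c ≤ n − |S|.  For the dual, swap the roles of A and its complement: colour
-- a basis by an element of T that it misses.
module Submission where

open import Defs
open import Data.Fin using (Fin; zero; suc; punchOut)
import Data.Fin as Fin
import Data.Fin.Properties as Fin
open import Data.Fin.Subset
open import Data.Fin.Subset.Induction using (Acc; acc; ⊂-wellFounded)
open import Data.Fin.Subset.Properties
open import Data.List using (List; []; _∷_; filter; deduplicate; allFin; lookup)
open import Data.List.Extrema.Nat using (max<v⁺; xs≤max)
open import Data.List.Membership.Propositional using () renaming (_∈_ to _∈ₗ_; _∉_ to _∉ₗ_)
open import Data.List.Membership.Propositional.Properties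
  using (∈-filter⁺; ∈-filter⁻; ∈-map⁺; ∈-++⁺ˡ; ∈-++⁺ʳ; ∈-cartesianProductWith⁺; ∈-lookup)
open import Data.List.Relation.Unary.All as All using (All; []; _∷_)
import Data.List.Relation.Unary.All.Properties as All
open import Data.List.Relation.Unary.Any using (here)
open import Data.List.Relation.Unary.AllPairs using (AllPairs; []; _∷_)
import Data.List.Relation.Unary.AllPairs.Properties as AllPairs
open import Data.Nat using (ℕ; zero; suc; _+_; _∸_; _≤_; _<_; _<?_; z≤n; s≤s; s<s⁻¹)
open import Data.Nat.Induction using (<-wellFounded)
open import Data.Nat.Properties hiding (_≟_; _<?_; suc-injective)
open import Data.Product using (Σ; ∃; _×_; _,_; proj₁; proj₂)
open import Data.Sum using (_⊎_; inj₁; inj₂; [_,_]′)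
open import Data.Vec using ([]; _∷_; here; there; tabulate)
open import Data.Vec.Properties using (lookup∘tabulate; []=⇒lookup; lookup⇒[]=)
open import Function using (_∘_; id)
open import Level using (0ℓ)
open import Relation.Binary.Construct.Add.Supremum.NonStrict _≤_ using ([_])
import Relation.Binary.Definitions as B
open import Relation.Binary.PropositionalEquality
open import Relation.Nullary using (¬_; Dec; yes; no; does; contradiction)
open import Relation.Nullary.Construct.Add.Supremum using ([_])
open import Relation.Nullary.Decidable
  using (¬?; _×-dec_; _→-dec_; map′; decidable-stable; dec-true)
open import Relation.Unary using (Pred; Decidable)

private variable
  n k : ℕ

-- Finite subsets

module _ {P : Pred (Fin n) 0ℓ} (P? : Decidable P) where

  ⟪_⟫ : Subset n
  ⟪_⟫ = tabulate (does ∘ P?)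

  ∈⟪⟫⁺ : ∀ {x} → P x → x ∈ ⟪_⟫
  ∈⟪⟫⁺ {x} px = lookup⇒[]= x _ (trans (lookup∘tabulate _ x) (dec-true (P? x) px))

  ∈⟪⟫⁻ : ∀ {x} → x ∈ ⟪_⟫ → P x
  ∈⟪⟫⁻ {x} i with P? x | trans (sym (lookup∘tabulate (does ∘ P?) x)) ([]=⇒lookup i)
  ... | yes px | _ = px

-- The rank of `x` among the elements of `p`, through which elements of a set serve as colours in
-- `Fin ∣ p ∣`.
index : ∀ {p : Subset n} {x} → x ∈ p → Fin ∣ p ∣
index {p = _       ∷ _} here      = zero
index {p = outside ∷ _} (there i) = index i
index {p = inside  ∷ _} (there i) = suc (index i)

index-injective : ∀ {p : Subset n} {x y} (i : x ∈ p) (j : y ∈ p) → index i ≡ index j → x ≡ y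
index-injective {p = _       ∷ _} here      here      _  = refl
index-injective {p = outside ∷ _} (there i) (there j) eq = cong suc (index-injective i j eq)
index-injective {p = inside  ∷ _} (there i) (there j) eq =
  cong suc (index-injective i j (Fin.suc-injective eq))

∣p∪q∣≤∣p∣+∣q∣ : ∀ (p q : Subset n) → ∣ p ∪ q ∣ ≤ ∣ p ∣ + ∣ q ∣
∣p∪q∣≤∣p∣+∣q∣ []            []            = z≤n
∣p∪q∣≤∣p∣+∣q∣ (outside ∷ p) (outside ∷ q) = ∣p∪q∣≤∣p∣+∣q∣ p q
∣p∪q∣≤∣p∣+∣q∣ (inside  ∷ p) (outside ∷ q) = s≤s (∣p∪q∣≤∣p∣+∣q∣ p q)
∣p∪q∣≤∣p∣+∣q∣ (outside ∷ p) (inside  ∷ q) =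
  ≤-trans (s≤s (∣p∪q∣≤∣p∣+∣q∣ p q)) (≤-reflexive (sym (+-suc ∣ p ∣ ∣ q ∣)))
∣p∪q∣≤∣p∣+∣q∣ (inside  ∷ p) (inside  ∷ q) =
  s≤s (≤-trans (∣p∪q∣≤∣p∣+∣q∣ p q) (+-monoʳ-≤ ∣ p ∣ (n≤1+n ∣ q ∣)))

∣p∣+∣q∣≤∣p∪q∣ : ∀ (p q : Subset n) → Empty (p ∩ q) → ∣ p ∣ + ∣ q ∣ ≤ ∣ p ∪ q ∣
∣p∣+∣q∣≤∣p∪q∣ []            []            e = z≤n
∣p∣+∣q∣≤∣p∪q∣ (outside ∷ p) (outside ∷ q) e = ∣p∣+∣q∣≤∣p∪q∣ p q (drop-∷-Empty e)
∣p∣+∣q∣≤∣p∪q∣ (inside  ∷ p) (outside ∷ q) e = s≤s (∣p∣+∣q∣≤∣p∪q∣ p q (drop-∷-Empty e))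
∣p∣+∣q∣≤∣p∪q∣ (outside ∷ p) (inside  ∷ q) e =
  ≤-trans (≤-reflexive (+-suc ∣ p ∣ ∣ q ∣)) (s≤s (∣p∣+∣q∣≤∣p∪q∣ p q (drop-∷-Empty e)))
∣p∣+∣q∣≤∣p∪q∣ (inside  ∷ p) (inside  ∷ q) e = contradiction (zero , here) e

∣p∪⁅x⁆∣≤∣p∣+1 : ∀ (p : Subset n) x → ∣ p ∪ ⁅ x ⁆ ∣ ≤ ∣ p ∣ + 1
∣p∪⁅x⁆∣≤∣p∣+1 p x =
  ≤-trans (∣p∪q∣≤∣p∣+∣q∣ p ⁅ x ⁆) (≤-reflexive (cong (∣ p ∣ +_) (∣⁅x⁆∣≡1 x)))

∁-involutive : ∀ (p : Subset n) → ∁ (∁ p) ≡ p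
∁-involutive p = ⊆-antisym (x∉∁p⇒x∈p ∘ x∈∁p⇒x∉p) (x∉p⇒x∈∁p ∘ x∈p⇒x∉∁p)

x∈p─q⇒x∉q : ∀ {p q : Subset n} {x} → x ∈ p ─ q → x ∉ q
x∈p─q⇒x∉q {p = _ ∷ _} {q = _ ∷ _} {zero}  ()        here
x∈p─q⇒x∉q {p = _ ∷ _} {q = _ ∷ _} {suc _} (there i) (there j) = x∈p─q⇒x∉q i j

∁p─∁q⊆q─p : ∀ {p q : Subset n} → ∁ p ─ ∁ q ⊆ q ─ p
∁p─∁q⊆q─p {p = p} {q} i =
  x∈p∧x∉q⇒x∈p─q (x∉∁p⇒x∈p (x∈p─q⇒x∉q i)) (x∈∁p⇒x∉p (p─q⊆p (∁ p) (∁ q) i))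

p─q⊆∁q─∁p : ∀ {p q : Subset n} → p ─ q ⊆ ∁ q ─ ∁ p
p─q⊆∁q─∁p {p = p} {q} i =
  x∈p∧x∉q⇒x∈p─q (x∉p⇒x∈∁p (x∈p─q⇒x∉q i)) (x∈p⇒x∉∁p (p─q⊆p p q i))

-- Complementation interchanges the two differences.
dist-∁ : ∀ (p q : Subset n) → dist (∁ p) (∁ q) ≡ dist p q
dist-∁ p q = cong ∣_∣ (trans
  (cong₂ _∪_ (⊆-antisym ∁p─∁q⊆q─p p─q⊆∁q─∁p) (⊆-antisym ∁p─∁q⊆q─p p─q⊆∁q─∁p))
  (∪-comm (q ─ p) (p ─ q)))

dist-meet : ∀ (p q : Subset n) {x} → x ∈ p → x ∈ q → dist p q < ∣ p ∣ + ∣ q ∣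
dist-meet p q x∈p x∈q = ≤-<-trans (∣p∪q∣≤∣p∣+∣q∣ (p ─ q) (q ─ p))
  (+-mono-<-≤ (p∩q≢∅⇒∣p─q∣<∣p∣ p q (_ , x∈p∩q⁺ (x∈p , x∈q))) (∣p─q∣≤∣p∣ q p))

dist-disjoint : ∀ (p q : Subset n) → Empty (p ∩ q) → ∣ p ∣ + ∣ q ∣ ≤ dist p q
dist-disjoint p q e = ≤-trans (∣p∣+∣q∣≤∣p∪q∣ p q e) (p⊆q⇒∣p∣≤∣q∣ λ i → x∈p∪q⁺ (sides i))
  where
  sides : ∀ {x} → x ∈ p ∪ q → x ∈ p ─ q ⊎ x ∈ q ─ p
  sides i with x∈p∪q⁻ p q i
  ... | inj₁ x∈p = inj₁ (x∈p∧x∉q⇒x∈p─q x∈p λ x∈q → e (_ , x∈p∩q⁺ (x∈p , x∈q)))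
  ... | inj₂ x∈q = inj₂ (x∈p∧x∉q⇒x∈p─q x∈q λ x∈p → e (_ , x∈p∩q⁺ (x∈p , x∈q)))

swap : Subset n → Fin n → Fin n → Subset n
swap p x y = (p - x) ∪ ⁅ y ⁆

module _ {p : Subset n} {x y : Fin n} where

  ∈-swap⁻ : ∀ {w} → w ∈ swap p x y → (w ∈ p × w ≢ x) ⊎ w ≡ y
  ∈-swap⁻ i with x∈p∪q⁻ (p - x) ⁅ y ⁆ i
  ... | inj₁ j = inj₁ (p─q⊆p p ⁅ x ⁆ j , x∉⁅y⁆⇒x≢y (x∈p─q⇒x∉q j))
  ... | inj₂ j = inj₂ (x∈⁅y⁆⇒x≡y y j)

  ∈-swap-old : ∀ {w} → w ∈ p → w ≢ x → w ∈ swap p x y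
  ∈-swap-old w∈p w≢x = x∈p∪q⁺ (inj₁ (x∈p∧x≢y⇒x∈p-y w∈p w≢x))

  ∈-swap-new : y ∈ swap p x y
  ∈-swap-new = x∈p∪q⁺ (inj₂ (x∈⁅x⁆ y))

swap-∁ : ∀ {p : Subset n} {x y} → x ∈ p → y ∉ p → ∁ (swap p x y) ≡ swap (∁ p) y x
swap-∁ {p = p} {x} {y} x∈p y∉p = ⊆-antisym to from
  where
  to : ∁ (swap p x y) ⊆ swap (∁ p) y x
  to {w} i with w Fin.≟ x
  ... | yes refl = ∈-swap-new {p = ∁ p} {x = y}
  ... | no w≢x = ∈-swap-old
    (x∉p⇒x∈∁p λ w∈p → x∈∁p⇒x∉p i (∈-swap-old w∈p w≢x))
    λ { refl → x∈∁p⇒x∉p i (∈-swap-new {p = p} {x = x}) }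
  from : swap (∁ p) y x ⊆ ∁ (swap p x y)
  from {w} i = x∉p⇒x∈∁p λ j → case (∈-swap⁻ {p = ∁ p} i) (∈-swap⁻ {p = p} j)
    where
    case : (w ∈ ∁ p × w ≢ y) ⊎ w ≡ x → ¬ ((w ∈ p × w ≢ x) ⊎ w ≡ y)
    case (inj₁ (w∈∁p , _)) (inj₁ (w∈p , _)) = x∈∁p⇒x∉p w∈∁p w∈p
    case (inj₁ (_ , w≢y))  (inj₂ w≡y)       = w≢y w≡y
    case (inj₂ w≡x)        (inj₁ (_ , w≢x)) = w≢x w≡x
    case (inj₂ refl)       (inj₂ refl)      = y∉p x∈p

swap-swap : ∀ {p : Subset n} {x y z} → y ∉ p → swap (swap p x y) y z ≡ swap p x z
swap-swap {p = p} {x} {y} {z} y∉p = ⊆-antisym to from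
  where
  to : swap (swap p x y) y z ⊆ swap p x z
  to i with ∈-swap⁻ {p = swap p x y} i
  ... | inj₂ refl = ∈-swap-new {p = p} {x = x}
  ... | inj₁ (j , w≢y) with ∈-swap⁻ {p = p} j
  ...   | inj₁ (w∈p , w≢x) = ∈-swap-old w∈p w≢x
  ...   | inj₂ w≡y         = contradiction w≡y w≢y
  from : swap p x z ⊆ swap (swap p x y) y z
  from i with ∈-swap⁻ {p = p} i
  ... | inj₂ refl        = ∈-swap-new {p = swap p x y} {x = y}
  ... | inj₁ (w∈p , w≢x) = ∈-swap-old (∈-swap-old w∈p w≢x) λ { refl → y∉p w∈p }

-- Removing `x` loses at most one element, and adding `y ∉ p` gains exactly one.
∣p∣≤∣swap∣ : ∀ {p : Subset n} {x y} → y ∉ p → ∣ p ∣ ≤ ∣ swap p x y ∣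
∣p∣≤∣swap∣ {p = p} {x} {y} y∉p = begin
  ∣ p ∣                 ≤⟨ p⊆q⇒∣p∣≤∣q∣ restore ⟩
  ∣ (p - x) ∪ ⁅ x ⁆ ∣   ≤⟨ ∣p∪⁅x⁆∣≤∣p∣+1 (p - x) x ⟩
  ∣ p - x ∣ + 1         ≡⟨ +-comm ∣ p - x ∣ 1 ⟩
  suc ∣ p - x ∣         ≤⟨ p⊂q⇒∣p∣<∣q∣ p-x⊂swap ⟩
  ∣ swap p x y ∣        ∎
  where
  open ≤-Reasoning
  p-x⊂swap : p - x ⊂ swap p x y
  p-x⊂swap = p⊆p∪q ⁅ y ⁆ , y , ∈-swap-new {p = p} {x = x} , y∉p ∘ p─q⊆p p ⁅ x ⁆
  restore : p ⊆ (p - x) ∪ ⁅ x ⁆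
  restore {w} w∈p with w Fin.≟ x
  ... | yes refl = ∈-swap-new {p = p} {x = x}
  ... | no w≢x   = ∈-swap-old w∈p w≢x

-- Bases and circuits

module _ (M : Matroid n) where
  open Matroid M using (basis?; exchange)

  ⊆-basis⇒≡ : ∀ {A B} → Basis M A → Basis M B → A ⊆ B → A ≡ B
  ⊆-basis⇒≡ {A} {B} bA bB A⊆B = ⊆-antisym A⊆B λ {x} x∈B →
    decidable-stable (x ∈? A) λ x∉A →
      let (y , y∈A , y∉B , _) = exchange bB bA x∈B x∉A in y∉B (A⊆B y∈A)

  -- Induction on `A ─ B`. Exchanging some `x` of `A ─ B` for some `y` of `B ─ A` does not shrink
  -- the basis, and its difference from `B` loses `x` and gains nothing. Once no such `x` is left,
  -- `A ⊆ B`.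
  ∣basis∣≤ : ∀ {A B} → Acc _⊂_ (A ─ B) → Basis M A → Basis M B → ∣ A ∣ ≤ ∣ B ∣
  ∣basis∣≤ {A} {B} (acc rec) bA bB with Fin.any? (λ x → (x ∈? A) ×-dec ¬? (x ∈? B))
  ... | no none = p⊆q⇒∣p∣≤∣q∣ λ {x} x∈A → decidable-stable (x ∈? B) λ x∉B → none (x , x∈A , x∉B)
  ... | yes (x , x∈A , x∉B) =
    let (y , y∈B , y∉A , b) = exchange bA bB x∈A x∉B
        closer : ∀ {w} → w ∈ swap A x y ─ B → w ∈ A × w ≢ x
        closer i = [ id , (λ { refl → contradiction y∈B (x∈p─q⇒x∉q i) }) ]′
                     (∈-swap⁻ {p = A} (p─q⊆p (swap A x y) B i))
    in ≤-trans (∣p∣≤∣swap∣ y∉A) (∣basis∣≤ (rec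
         ( (λ i → x∈p∧x∉q⇒x∈p─q (proj₁ (closer i)) (x∈p─q⇒x∉q i))
         , x , x∈p∧x∉q⇒x∈p─q x∈A x∉B , λ i → proj₂ (closer i) refl)) b bB)

  ∣basis∣≡ : ∀ {A B} → Basis M A → Basis M B → ∣ A ∣ ≡ ∣ B ∣
  ∣basis∣≡ bA bB = ≤-antisym (∣basis∣≤ (⊂-wellFounded _) bA bB) (∣basis∣≤ (⊂-wellFounded _) bB bA)

  dist-meet<dist-disjoint : ∀ {A A′ B B′ x} → Basis M A → Basis M A′ → Empty (A ∩ A′) →
    Basis M B → Basis M B′ → x ∈ B → x ∈ B′ → dist B B′ < dist A A′
  dist-meet<dist-disjoint {A} {A′} {B} {B′} bA bA′ e bB bB′ i j = begin-strict
    dist B B′        <⟨ dist-meet B B′ i j ⟩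
    ∣ B ∣ + ∣ B′ ∣   ≡⟨ cong₂ _+_ (∣basis∣≡ bB bA) (∣basis∣≡ bB′ bA′) ⟩
    ∣ A ∣ + ∣ A′ ∣   ≤⟨ dist-disjoint A A′ e ⟩
    dist A A′        ∎
    where open ≤-Reasoning

  -- An empty basis would lie inside the other one and so equal it. This supplies the element `e`.
  distinct-bases⇒nonempty : ∀ {A B} → Basis M A → Basis M B → A ≢ B → Nonempty A
  distinct-bases⇒nonempty {A} bA bB A≢B = decidable-stable (nonempty? A) λ empty →
    A≢B (⊆-basis⇒≡ bA bB λ x∈A → contradiction (_ , x∈A) empty)

  dependent⇒circuit : ∀ {X} → Acc _⊂_ X → ¬ Independent M X → ∃ λ C → Circuit M C × C ⊆ X
  dependent⇒circuit {X} (acc rec) dep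
    with anySubset? (λ Y → (Y ⊂? X) ×-dec ¬? (independent? M Y))
  ... | no none = X , (dep , λ Y Y⊂X →
    decidable-stable (independent? M Y) λ depY → none (Y , Y⊂X , depY)) , id
  ... | yes (Y , Y⊂X , depY) =
    let (C , circuit , C⊆Y) = dependent⇒circuit (rec Y⊂X) depY
    in C , circuit , proj₁ Y⊂X ∘ C⊆Y

  -- For a basis `A`, the edges of its fundamental graph, bipartite between `A` and its complement:
  -- `a` leaves and `x` enters.
  Exchangeable : Subset n → Fin n → Fin n → Set
  Exchangeable A a x = a ∈ A × x ∉ A × Basis M (swap A a x)

  exchangeable? : ∀ A → B.Decidable (Exchangeable A)
  exchangeable? A a x = (a ∈? A) ×-dec ¬? (x ∈? A) ×-dec basis? (swap A a x)

  -- A basis above `A ∪ ⁅ x ⁆` would equal `A`, so this set contains a circuit `C`. It passes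
  -- through `x`, since otherwise `C ⊆ A`. If it missed an exchangeable `a`, it would lie in the
  -- basis `swap A a x`. One `C` serves every `a`, so any two such `a` are connected.
  fundamental-circuit : ∀ {A x} → Basis M A → x ∉ A →
    ∃ λ C → Circuit M C × x ∈ C × (∀ {a} → Exchangeable A a x → a ∈ C)
  fundamental-circuit {A} {x} bA x∉A =
    C , circuit , x∈C , λ {a} (a∈A , _ , b) → decidable-stable (a ∈? C) λ a∉C →
      proj₁ circuit (_ , b , λ {w} w∈C →
        [ (λ w∈A → ∈-swap-old w∈A λ { refl → a∉C w∈C })
        , (λ { refl → ∈-swap-new {p = A} {x = a} }) ]′ (⊆A∪x w∈C))
    where
    dependent : ¬ Independent M (A ∪ ⁅ x ⁆)
    dependent (B , bB , sub) = x∉A (subst (x ∈_)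
      (sym (⊆-basis⇒≡ bA bB (sub ∘ p⊆p∪q ⁅ x ⁆))) (sub (x∈p∪q⁺ (inj₂ (x∈⁅x⁆ x)))))

    found   = dependent⇒circuit (⊂-wellFounded _) dependent
    C       = proj₁ found
    circuit = proj₁ (proj₂ found)

    ⊆A∪x : ∀ {w} → w ∈ C → w ∈ A ⊎ w ≡ x
    ⊆A∪x w∈C with x∈p∪q⁻ A ⁅ x ⁆ (proj₂ (proj₂ found) w∈C)
    ... | inj₁ w∈A = inj₁ w∈A
    ... | inj₂ w∈x = inj₂ (x∈⁅y⁆⇒x≡y x w∈x)

    x∈C : x ∈ C
    x∈C = decidable-stable (x ∈? C) λ x∉C → proj₁ circuit (A , bA , λ w∈C →
      [ id , (λ { refl → contradiction w∈C x∉C }) ]′ (⊆A∪x w∈C))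

  Connected-sym : ∀ {x y} → Connected M x y → Connected M y x
  Connected-sym (inj₁ x≡y)              = inj₁ (sym x≡y)
  Connected-sym (inj₂ (C , c , i , j)) = inj₂ (C , c , j , i)

  module _ {A} (bA : Basis M A) where

    exchangeable⇒connected : ∀ {a x} → Exchangeable A a x → Connected M a x
    exchangeable⇒connected ex@(_ , x∉A , _) =
      let (C , c , x∈C , sub) = fundamental-circuit bA x∉A in inj₂ (C , c , sub ex , x∈C)

    exchangeable-same-in : ∀ {a b x} → Exchangeable A a x → Exchangeable A b x → Connected M a b
    exchangeable-same-in ex@(_ , x∉A , _) ex′ =
      let (C , c , _ , sub) = fundamental-circuit bA x∉A in inj₂ (C , c , sub ex , sub ex′)

  -- With respect to the basis A − a + x, y is exchangeable for x.
  exchangeable-same-out : ∀ {A a x y} →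
    Exchangeable A a x → Exchangeable A a y → Connected M x y
  exchangeable-same-out {A} {a} {x} {y} (_ , x∉A , bx) (_ , y∉A , by) with x Fin.≟ y
  ... | yes x≡y = inj₁ x≡y
  ... | no x≢y  = exchangeable⇒connected bx
    ( ∈-swap-new {p = A} {x = a}
    , (λ i → [ y∉A ∘ proj₁ , x≢y ∘ sym ]′ (∈-swap⁻ {p = A} i))
    , subst (Basis M) (sym (swap-swap x∉A)) by)

  -- The exchange axiom of `M ⋆` for `∁ A` and `∁ B`: there `x` leaves and `a` enters, and taking
  -- complements reverses the two roles.
  coexchange : ∀ {A B x} → Basis M A → Basis M B → x ∈ B → x ∉ A →
               ∃ λ a → Exchangeable A a x
  coexchange {A} {B} {x} bA bB x∈B x∉A =
    let (a , a∈∁B , a∉∁A , b) = Matroid.exchange (M ⋆) {∁ A} {∁ B} {x}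
          (subst (Basis M) (sym (∁-involutive A)) bA)
          (subst (Basis M) (sym (∁-involutive B)) bB) (x∉p⇒x∈∁p x∉A) (x∈p⇒x∉∁p x∈B)
    in a , x∉∁p⇒x∈p a∉∁A , x∉A , subst (Basis M)
         (trans (swap-∁ (x∉p⇒x∈∁p x∉A) a∉∁A) (cong (λ p → swap p a x) (∁-involutive A))) b

  -- A basis that avoids `S` is contained in `A` and hence equal to it; `e` covers this case.
  meets-transversal : ∀ {A B S e} → Basis M A → Basis M B → e ∈ A →
    (∀ {x} → x ∈ B → x ∉ A → x ∈ S) → ∃ λ x → x ∈ S ∪ ⁅ e ⁆ × x ∈ B
  meets-transversal {A} {B} {S} {e} bA bB e∈A B─A⊆S
    with Fin.any? (λ x → (x ∈? S ∪ ⁅ e ⁆) ×-dec (x ∈? B))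
  ... | yes found = found
  ... | no none   = e , x∈p∪q⁺ (inj₂ (x∈⁅x⁆ e)) , subst (e ∈_) (sym (⊆-basis⇒≡ bB bA B⊆A)) e∈A
    where
    B⊆A : B ⊆ A
    B⊆A {x} x∈B = decidable-stable (x ∈? A) λ x∉A →
      none (x , x∈p∪q⁺ (inj₁ (B─A⊆S x∈B x∉A)) , x∈B)

-- Counting components

-- Each kept element filters only those after it, so the conclusion is directed along the list.
deduplicate-pairs : ∀ {X : Set} {R : X → X → Set} (R? : B.Decidable R) xs →
                    AllPairs (λ x y → ¬ R x y) (deduplicate R? xs)
deduplicate-pairs R? []       = []
deduplicate-pairs R? (x ∷ xs) =
  All.all-filter (¬? ∘ R? x) (deduplicate R? xs) ∷
  AllPairs.filter⁺ (¬? ∘ R? x) (deduplicate-pairs R? xs)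

AllPairs-lookup : ∀ {X : Set} {R : X → X → Set} {xs} → AllPairs R xs →
                  ∀ {i j} → i Fin.< j → R (lookup xs i) (lookup xs j)
AllPairs-lookup (px ∷ _)  {zero}  {suc j} _   = All.lookup px (∈-lookup j)
AllPairs-lookup (_ ∷ pxs) {suc i} {suc j} i<j = AllPairs-lookup pxs (s<s⁻¹ i<j)

module _ (M : Matroid n) where

  -- If the representatives outnumbered `K`, two of them would have the same image under `g` and so
  -- be connected, but distinct representatives are not.
  #components≤ : ∀ (K : Subset n) (g : Fin n → Fin n) → (∀ x → g x ∈ K) →
    (∀ x y → g x ≡ g y → Connected M x y) → #components M ≤ ∣ K ∣
  #components≤ K g g∈K fibre = ≮⇒≥ λ ∣K∣<c →
    let reps              = deduplicate (connected? M) (allFin n)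
        (i , j , i<j , eq) = Fin.pigeonhole ∣K∣<c (λ i → index (g∈K (lookup reps i)))
    in AllPairs-lookup (deduplicate-pairs (connected? M) (allFin n)) i<j
         (fibre _ _ (index-injective (g∈K _) (g∈K _) eq))

  module _ {R : Fin n → Fin n → Set} (R? : B.Decidable R) where

    sources : Subset n
    sources = ⟪ (λ x → Fin.any? (R? x)) ⟫

    -- For a bipartite R, replacing each source by an R-successor is a
    -- retraction onto the complement of the sources.
    ∣sources∪⁅e⁆∣≤ : (∀ {x y z} → R x y → ¬ R y z) → (∀ {x y} → R x y → Connected M x y) →
      (∀ {x y z} → R x z → R y z → Connected M x y) →
      ∀ e → ∣ sources ∪ ⁅ e ⁆ ∣ ≤ n ∸ #components M + 1
    ∣sources∪⁅e⁆∣≤ bipartite edge same e =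
      ≤-trans (∣p∪⁅x⁆∣≤∣p∣+1 sources e) (+-monoˡ-≤ 1 ∣S∣≤n∸c)
      where
      retract : ∀ {x} → Dec (∃ (R x)) → Fin n
      retract     (yes (y , _)) = y
      retract {x} (no _)        = x

      source⁻ : ∀ {x} → x ∈ sources → ∃ (R x)
      source⁻ = ∈⟪⟫⁻ λ x → Fin.any? (R? x)

      retract∈∁ : ∀ {x} (d : Dec (∃ (R x))) → retract d ∈ ∁ sources
      retract∈∁ (yes (_ , xRy)) = x∉p⇒x∈∁p λ i → bipartite xRy (proj₂ (source⁻ i))
      retract∈∁ (no none)       = x∉p⇒x∈∁p (none ∘ source⁻)

      fibre : ∀ {x y} (d : Dec (∃ (R x))) (d′ : Dec (∃ (R y))) →
              retract d ≡ retract d′ → Connected M x y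
      -- Either two sources share a successor, or one of the elements is the chosen successor of the
      -- other, or the elements coincide.
      fibre (yes (_ , r)) (yes (_ , r′)) refl = same r r′
      fibre (yes (_ , r)) (no _)         refl = edge r
      fibre (no _)        (yes (_ , r))  refl = Connected-sym M (edge r)
      fibre (no _)        (no _)         refl = inj₁ refl

      c≤n∸∣S∣ : #components M ≤ n ∸ ∣ sources ∣
      c≤n∸∣S∣ = subst (#components M ≤_) (∣∁p∣≡n∸∣p∣ sources)
        (#components≤ (∁ sources) (λ x → retract (Fin.any? (R? x)))
          (λ x → retract∈∁ (Fin.any? (R? x)))
          (λ x y → fibre (Fin.any? (R? x)) (Fin.any? (R? y))))

      -- As `∣ S ∣ ≤ n`, the subtraction in `c ≤ n ∸ ∣ S ∣` is exact, which permits interchanging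
      -- `c` and `∣ S ∣`.
      ∣S∣≤n∸c : ∣ sources ∣ ≤ n ∸ #components M
      ∣S∣≤n∸c = m+n≤o⇒m≤o∸n _ (subst (_≤ n) (+-comm (#components M) _)
        (m≤o∸n⇒m+n≤o _ (∣p∣≤n sources) c≤n∸∣S∣))

-- The Borsuk number as a least number of colours

least : ∀ {P : Pred ℕ 0ℓ} → Decidable P → ∀ {m} → Acc _<_ m → P m →
        ∃ λ k → k ≤ m × P k × (∀ j → P j → k ≤ j)
least P? {m} (acc rec) pm with anyUpTo? P? m
... | no none = m , ≤-refl , pm , λ j pj → ≮⇒≥ λ j<m → none (j , j<m , pj)
... | yes (j , j<m , pj) =
  let (k , k≤j , rest) = least P? (rec j<m) pj in k , ≤-trans k≤j (<⇒≤ j<m) , rest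

glue : ∀ {X : Set} → (Subset n → X) → (Subset n → X) → Subset (suc n) → X
glue f g (outside ∷ p) = f p
glue f g (inside  ∷ p) = g p

-- Exhaustive search: a colouring of the subsets of `Fin (suc n)` is a pair of colourings of the
-- subsets of `Fin n`, split by the first element. It is recovered by `glue` only pointwise, so `P`
-- has to respect `≗`.
anyColouring? : ∀ n {P : (Subset n → Fin k) → Set} → (∀ {f g} → f ≗ g → P f → P g) →
                Decidable P → Dec (∃ P)
anyColouring? zero resp P? = map′ (λ (c , p) → (λ _ → c) , p)
  (λ (f , p) → f [] , resp (λ { [] → refl }) p) (Fin.any? λ c → P? λ _ → c)
anyColouring? (suc n) resp P? = map′
  (λ (f , g , p) → glue f g , p)
  (λ (f , p) → f ∘ (outside ∷_) , f ∘ (inside ∷_) ,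
               resp (λ { (outside ∷ _) → refl ; (inside ∷ _) → refl }) p)
  (anyColouring? n
    (λ eq (g , p) → g , resp (λ { (outside ∷ q) → eq q ; (inside ∷ _) → refl }) p)
    λ f → anyColouring? n
      (λ eq → resp (λ { (outside ∷ _) → refl ; (inside ∷ q) → eq q }))
      λ g → P? (glue f g))

∈-subsets : ∀ (p : Subset n) → p ∈ₗ subsets n
∈-subsets []            = here refl
∈-subsets (outside ∷ p) = ∈-++⁺ˡ (∈-map⁺ (outside ∷_) (∈-subsets p))
∈-subsets (inside  ∷ p) = ∈-++⁺ʳ _ (∈-map⁺ (inside ∷_) (∈-subsets p))

dist≤diam : ∀ {𝓐 : List (Subset n)} {A B} → A ∈ₗ 𝓐 → B ∈ₗ 𝓐 → dist A B ≤ diam 𝓐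
dist≤diam i j = All.lookup (xs≤max 0 _) (∈-cartesianProductWith⁺ dist i j)

-- The maximum in `diam` starts at 0, whence the premise `0 < d`.
diam<⁺ : ∀ {𝓐 : List (Subset n)} {d} → 0 < d →
         (∀ {A B} → A ∈ₗ 𝓐 → B ∈ₗ 𝓐 → dist A B < d) → diam 𝓐 < d
diam<⁺ 0<d small = max<v⁺ 0<d
  (All.cartesianProductWith⁺ (setoid _) (setoid _) dist _ _ small)

∉⇒≡[] : ∀ {X : Set} (xs : List X) → (∀ {x} → x ∉ₗ xs) → xs ≡ []
∉⇒≡[] []       _    = refl
∉⇒≡[] (x ∷ xs) none = contradiction (here refl) none

module _ (M : Matroid n) where
  open Matroid M using (basis?; nonempty)

  ∈-bases⁺ : ∀ {B} → Basis M B → B ∈ₗ bases M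
  ∈-bases⁺ {B} = ∈-filter⁺ basis? (∈-subsets B)

  ∈-bases⁻ : ∀ {B} → B ∈ₗ bases M → Basis M B
  ∈-bases⁻ = proj₂ ∘ ∈-filter⁻ basis? {xs = subsets n}

  Separating : (Subset n → Fin k) → Set
  Separating f = ∀ {A B} → A ∈ₗ bases M → B ∈ₗ bases M → f A ≡ f B → dist A B < diam (bases M)

  separating? : Decidable (Separating {k})
  separating? f = map′ (λ all i j → All.lookup (All.lookup all i) j)
    (λ sep → All.tabulate λ i → All.tabulate λ j → sep i j)
    (All.all? (λ A → All.all? (λ B → (f A Fin.≟ f B) →-dec (dist A B <? diam (bases M))) (bases M))
      (bases M))

  -- A Borsuk partition whose parts may be empty. This weaker notion is decided by search, and both
  -- notions have the same least number of colours.
  Colourable : ℕ → Set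
  Colourable k = Σ (Subset n → Fin k) Separating

  colourable? : Decidable Colourable
  colourable? k = anyColouring? n
    (λ {f} {g} eq sep {A} {B} i j gA≡gB → sep i j (trans (eq A) (trans gA≡gB (sym (eq B)))))
    separating?

  partition⇒colourable : BorsukPartition M k → Colourable k
  partition⇒colourable π = colour , λ {A} {B} i j eq →
    ≤-<-trans (dist≤diam (∈-filter⁺ (λ C → colour C Fin.≟ colour B) i eq)
                         (∈-filter⁺ (λ C → colour C Fin.≟ colour B) j refl))
              (part-diam (colour B))
    where open BorsukPartition π

  -- `punchOut` at `i` is injective on the remaining colours, so bases that agree afterwards agreed
  -- before.
  drop-unused : ∀ {f : Subset n → Fin (suc k)} → Separating f → ∀ i →
                (∀ {B} → B ∈ₗ bases M → i ≢ f B) → Colourable k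
  drop-unused {k} {f} sep i unused = colour , λ {A} {B} a b → sep a b ∘ colour-injective a b
    where
    B₀ = proj₁ nonempty

    -- The subsets of colour i are no bases; they get the colour of B₀.
    recolour : ∀ {c} → Dec (i ≡ c) → Fin k
    recolour (yes _)  = punchOut (unused (∈-bases⁺ (proj₂ nonempty)))
    recolour (no i≢c) = punchOut i≢c

    colour : Subset n → Fin k
    colour B = recolour (i Fin.≟ f B)

    colour-injective : ∀ {A B} → A ∈ₗ bases M → B ∈ₗ bases M → colour A ≡ colour B → f A ≡ f B
    colour-injective {A} {B} a b eq with i Fin.≟ f A | i Fin.≟ f B
    ... | yes i≡fA | _        = contradiction i≡fA (unused a)
    ... | no _     | yes i≡fB = contradiction i≡fB (unused b)
    ... | no i≢fA  | no i≢fB  = Fin.punchOut-injective i≢fA i≢fB eq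

  -- An empty part would be a colour that no basis uses; dropping it contradicts minimality.
  minimal⇒partition : Colourable k → (∀ j → Colourable j → k ≤ j) → BorsukPartition M k
  minimal⇒partition {k} (f , sep) minimal = record
    { colour        = f
    ; part-nonempty = nonempty-part minimal sep
    ; part-diam     = λ i → diam<⁺ 0<diam λ a b →
        let (a∈ , fA≡i) = ∈-filter⁻ (λ B → f B Fin.≟ i) {xs = bases M} a
            (b∈ , fB≡i) = ∈-filter⁻ (λ B → f B Fin.≟ i) {xs = bases M} b
        in sep a∈ b∈ (trans fA≡i (sym fB≡i))
    }
    where
    0<diam : 0 < diam (bases M)
    -- A basis has the same colour as itself, so `sep` already forces a positive diameter.
    0<diam = let b = ∈-bases⁺ (proj₂ nonempty) in ≤-<-trans z≤n (sep b b refl)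

    nonempty-part : ∀ {k} {f : Subset n → Fin k} → (∀ j → Colourable j → k ≤ j) → Separating f →
                    ∀ i → filter (λ B → f B Fin.≟ i) (bases M) ≢ []
    nonempty-part {suc k} {f} minimal sep i empty = 1+n≰n (minimal k (drop-unused sep i λ b i≡fB →
      contradiction (subst (_ ∈ₗ_) empty (∈-filter⁺ (λ B → f B Fin.≟ i) b (sym i≡fB))) λ ()))

  -- The least number of colours is the Borsuk number, and two distinct bases exclude the value +∞.
  colourable⇒borsuk : ∀ {A B} → Basis M A → Basis M B → A ≢ B →
    Colourable k → k ≤ n ∸ #components M + 1 → BorsukProperty M
  colourable⇒borsuk bA bB A≢B col k≤ =
    let (m , m≤k , colₘ , minimal) = least colourable? (<-wellFounded _) col
    in [ m ] ,
       ( (λ (_ , _ , unique) → A≢B (trans (sym (unique bA)) (unique bB)))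
       , minimal⇒partition colₘ minimal
       , λ j π → minimal j (partition⇒colourable π)) ,
       [ ≤-trans m≤k k≤ ]

  -- A basis `B` is coloured by an element of `T` in `h B`; equal colours give a shared element. The
  -- map `h` is `id` for disjoint bases of `M` and `∁` for those of `M ⋆`.
  transversal⇒colourable : ∀ (T : Subset n) (h : Subset n → Subset n) →
    (∀ {B} → Basis M B → ∃ λ x → x ∈ T × x ∈ h B) →
    (∀ {A B x} → Basis M A → Basis M B → x ∈ h A → x ∈ h B → dist A B < diam (bases M)) →
    Colourable ∣ T ∣
  transversal⇒colourable T h pick close = colour , λ a b → separate (∈-bases⁻ a) (∈-bases⁻ b)
    where
    colour′ : ∀ {B} → Dec (Basis M B) → Fin ∣ T ∣
    colour′ (yes b) = index (proj₁ (proj₂ (pick b)))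
    -- Subsets that are not bases get the colour of a fixed basis, merely to make the colouring
    -- total.
    colour′ (no _)  = index (proj₁ (proj₂ (pick (proj₂ nonempty))))

    colour : Subset n → Fin ∣ T ∣
    colour B = colour′ (basis? B)

    separate : ∀ {A B} → Basis M A → Basis M B → colour A ≡ colour B → dist A B < diam (bases M)
    separate {A} {B} bA bB eq with basis? A | basis? B
    ... | no ¬bA | _      = contradiction bA ¬bA
    ... | yes _  | no ¬bB = contradiction bB ¬bB
    ... | yes a  | yes b  = close a b (proj₂ (proj₂ (pick a)))
      (subst (_∈ h B) (sym (index-injective {p = T} _ _ eq)) (proj₂ (proj₂ (pick b))))

-- Disjoint bases of the matroid or of its dual

module _ (M : Matroid n) where
  open Matroid M using (exchange)

  disjoint⇒borsuk : HasDisjointBases M → BorsukProperty M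
  disjoint⇒borsuk (A , A′ , bA , bA′ , A≢A′ , disjoint) =
    colourable⇒borsuk M bA bA′ A≢A′
      (transversal⇒colourable M (S ∪ ⁅ e ⁆) id
        (λ bB → meets-transversal M bA bB e∈A λ x∈B x∉A →
          ∈⟪⟫⁺ (λ x → Fin.any? (R? x)) (coexchange M bA bB x∈B x∉A))
        (λ bB bB′ i j → <-≤-trans
          (dist-meet<dist-disjoint M bA bA′ disjoint bB bB′ i j)
          (dist≤diam (∈-bases⁺ M bA) (∈-bases⁺ M bA′))))
      (∣sources∪⁅e⁆∣≤ M R?
        (λ (a∈A , _) (_ , a∉A , _) → a∉A a∈A)
        (Connected-sym M ∘ exchangeable⇒connected M bA)
        (exchangeable-same-out M)
        e)
    where
    -- The arguments are flipped so that the sources lie outside `A`.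
    R? : B.Decidable (λ x a → Exchangeable M A a x)
    R? x a = exchangeable? M A a x
    S   = sources M R?
    e   = proj₁ (distinct-bases⇒nonempty M bA bA′ A≢A′)
    e∈A = proj₂ (distinct-bases⇒nonempty M bA bA′ A≢A′)

  -- By definition `X` is a basis of `M ⋆` exactly when `∁ X` is one of `M`. Sizes and transversals
  -- are treated in `M ⋆`, but exchanges are read in `M` relative to `∁ X`, so that connectedness
  -- comes from circuits of `M`, as `#components M` demands.
  codisjoint⇒borsuk : HasDisjointBases (M ⋆) → BorsukProperty M
  codisjoint⇒borsuk (X , X′ , bX , bX′ , X≢X′ , disjoint) =
    colourable⇒borsuk M bX bX′ (X≢X′ ∘ ∁-injective)
      (transversal⇒colourable M (S ∪ ⁅ e ⁆) ∁
        (λ {B} bB → meets-transversal (M ⋆) bX (dual bB) e∈X λ x∈∁B x∉X →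
          -- Here `x` belongs to the basis `∁ X` and not to `B`, so the axiom of `M` itself yields a
          -- partner.
          let (y , _ , y∉A , b) = exchange bX bB (x∉p⇒x∈∁p x∉X) (x∈∁p⇒x∉p x∈∁B)
          in ∈⟪⟫⁺ (λ x → Fin.any? (R? x)) (y , x∉p⇒x∈∁p x∉X , y∉A , b))
        (λ {B} {B′} bB bB′ i j → <-≤-trans
          (subst₂ _<_ (dist-∁ B B′) (sym (dist-∁ X X′))
            (dist-meet<dist-disjoint (M ⋆) bX bX′ disjoint (dual bB) (dual bB′) i j))
          (dist≤diam (∈-bases⁺ M bX) (∈-bases⁺ M bX′))))
      (∣sources∪⁅e⁆∣≤ M R?
        (λ (_ , x∉A , _) (x∈A , _) → x∉A x∈A)
        (exchangeable⇒connected M bX)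
        (exchangeable-same-in M bX)
        e)
    where
    R?  = exchangeable? M (∁ X)
    S   = sources M R?
    e   = proj₁ (distinct-bases⇒nonempty (M ⋆) bX bX′ X≢X′)
    e∈X = proj₂ (distinct-bases⇒nonempty (M ⋆) bX bX′ X≢X′)

    dual : ∀ {B} → Basis M B → Basis (M ⋆) (∁ B)
    dual {B} = subst (Basis M) (sym (∁-involutive B))

    ∁-injective : ∀ {p q : Subset n} → ∁ p ≡ ∁ q → p ≡ q
    ∁-injective {p} {q} eq = trans (sym (∁-involutive p)) (trans (cong ∁ eq) (∁-involutive q))

theorem1 : ∀ {n : ℕ} (M : Matroid n) →
    HasDisjointBases M ⊎ HasDisjointBases (M ⋆) → BorsukProperty M
theorem1 M = [ disjoint⇒borsuk M , codisjoint⇒borsuk M ]′
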